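{- Let $\pi$ be a permutation of length $n$ of the form $1\,n\cdots 2$ (i.e. $\pi(1)=1$, $\pi(2)=n$, $\pi(n)=2$) such that $\pi$ has no decreasing bond. Then the class $\operatorname{Av}(\pi)$ is not deflatable.
   Context: A permutation $\alpha$ is contained in $\beta$ if $\beta$ has a subsequence in the same relative order as $\alpha$; a class is a set of permutations closed under taking contained permutations; $\operatorname{Av}(\pi)$ is the class of permutations not containing $\pi$. A bond of a permutation is a pair of entries in adjacent positions whose values differ by $1$; it is decreasing if they form the pattern $21$. An interval of a permutation is a set of entries whose positions and values each form a set of consecutive integers, the whole permutation not counting as an interval; a permutation is simple if all its intervals are single entries (so $1$, $12$, $21$ are simple). A class $\mathcal{C}$ is deflatable if there is a proper subclass $\mathcal{D}\subsetneq\mathcal{C}$ with $\mathcal{C}\subseteq\langle\mathcal{D}\rangle$, where the substitution closure $\langle\mathcal{D}\rangle$ is the largest class whose simple permutations are exactly those of $\mathcal{D}$; equivalently, $\mathcal{C}$ is not deflatable if and only if every permutation in $\mathcal{C}$ is contained in some simple permutation belonging to $\mathcal{C}$. -}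

module Defs where

open import Level using (Level; 0ℓ) renaming (suc to lsuc)
open import Data.Nat using (ℕ; zero; suc; _+_; _∸_; _≤_; _<_)
open import Data.Fin as F using (Fin; toℕ)
open import Data.Product using (Σ; ∃; _×_; _,_)
open import Relation.Binary.PropositionalEquality using (_≡_; _≢_)
open import Relation.Nullary using (¬_)
open import Function.Definitions using (Injective)
open import Function.Bundles using (_⇔_)

-- A permutation of length len: an injective map Fin len → Fin len
-- (position ↦ value, both 0-indexed).
record Perm : Set where
  constructor perm
  field
    len : ℕ
    fun : Fin len → Fin len
    inj : Injective _≡_ _≡_ fun
open Perm public

_≼_ : Perm → Perm → Set
α ≼ β = Σ (Fin (len α) → Fin (len β)) λ e →
          (∀ i j → i F.< j → e i F.< e j) ×
          (∀ i j → (fun α i F.< fun α j) ⇔ (fun β (e i) F.< fun β (e j)))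

PermSet : Set₁
PermSet = Perm → Set

_⊆_ : PermSet → PermSet → Set
C ⊆ D = ∀ σ → C σ → D σ

IsClass : PermSet → Set
IsClass C = ∀ α β → α ≼ β → C β → C α

Av : Perm → PermSet
Av π σ = ¬ (π ≼ σ)

InWindow : {n : ℕ} → ℕ → ℕ → Fin n → Set
InWindow a b i = a ≤ toℕ i × toℕ i ≤ b

IsInterval : Perm → ℕ → ℕ → Set
IsInterval σ a b =
  a ≤ b × b < len σ ×
  (∃ λ c → ∀ (v : Fin (len σ)) →
      ((c ≤ toℕ v × toℕ v ≤ c + (b ∸ a))
        ⇔ (∃ λ i → InWindow a b i × fun σ i ≡ v))) ×
  ¬ (a ≡ 0 × suc b ≡ len σ)

Simple : Perm → Set
Simple σ = ∀ a b → IsInterval σ a b → a ≡ b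

-- Substitution closure ⟨D⟩: the largest class whose simple permutations
-- are exactly those of D, i.e. the union of all such classes.
SubstClosure : PermSet → Perm → Set₁
SubstClosure D σ =
  Σ PermSet λ E → IsClass E × (∀ s → Simple s → (E s ⇔ D s)) × E σ

Deflatable : PermSet → Set₁
Deflatable C =
  Σ PermSet λ D → IsClass D × D ⊆ C × (∃ λ σ → C σ × ¬ D σ) ×
    (∀ σ → C σ → SubstClosure D σ)

HasDecreasingBond : Perm → Set
HasDecreasingBond π =
  ∃ λ (i : Fin (len π)) → ∃ λ (j : Fin (len π)) →
    toℕ j ≡ suc (toℕ i) × toℕ (fun π i) ≡ suc (toℕ (fun π j))

-- π has the form 1 n ⋯ 2 (1-indexed: π(1)=1, π(2)=n, π(n)=2), here 0-indexed.
FormOneNTwo : Perm → Set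
FormOneNTwo π =
  (∀ i → toℕ i ≡ 0 → toℕ (fun π i) ≡ 0) ×
  (∀ i → toℕ i ≡ 1 → toℕ (fun π i) ≡ len π ∸ 1) ×
  (∀ i → toℕ i ≡ len π ∸ 1 → toℕ (fun π i) ≡ 1)

{-# OPTIONS --safe #-}

-- Every σ avoiding π is contained in a simple permutation avoiding π.  Walk along the lower-left
-- boundary of the diagram of σ, from its top left to its bottom right corner, crossing one row or
-- one column per unit of time; an entry e has its row crossed at a time R e and its column at a
-- later time C e.  With time as horizontal and reversed vertical axis, σ becomes the set of points
-- (C e , R e), i.e. of arcs from R e to C e.  Adding a point q t of the diagonal at each (refined)
-- time t makes the q t the left-to-right minima, with little between consecutive ones, and a
-- further arc w t straddling exactly q t and q (t + 1) chains them together, so that no proper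
-- interval survives.  In an occurrence of π the entry 1 may be taken to be some q t; all other
-- entries straddle t.  There w (t - 1) is the leftmost and w t the lowest, so they can only play n
-- and 2, and even that fails because between these entries π has at least two more, which would
-- have to share one time slot.  So the other entries all belong to σ, and by construction of the
-- path σ has a point to the lower left of them all: π is contained in σ.
module Submission where

open import Defs
open import Data.Fin as F using (Fin; zero; suc; toℕ; fromℕ; fromℕ<; punchOut; splitAt; join)
open import Data.Fin.Properties as FP
  using (any?; toℕ-injective; toℕ<n; toℕ-fromℕ; toℕ-fromℕ<; fromℕ<-toℕ; punchOut-injective;
         injective⇒≤; splitAt-join; join-splitAt)
open import Data.Fin.Subset using (Subset; _∈_; ∣_∣)
open import Data.Fin.Subset.Properties using (p⊆q⇒∣p∣≤∣q∣; p⊂q⇒∣p∣<∣q∣; ∣p∣≤n)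
open import Data.Nat using (ℕ; zero; suc; _+_; _*_; _∸_; _≤_; _<_; z≤n; s≤s)
open import Data.Nat.Properties as ℕ
  using (≤-trans; ≤-reflexive; <-trans; <-≤-trans; ≤-<-trans; <⇒≤; <⇒≱; <-irrefl; <-cmp; _<?_;
         n<1+n; m≤m+n)
open import Data.Product using (Σ; ∃; _×_; _,_; proj₁; proj₂)
open import Data.Product.Relation.Binary.Lex.Strict using (×-Lex; ×-transitive; ×-compare)
open import Data.Sum as Sum using (_⊎_; inj₁; inj₂; [_,_]′)
open import Data.Unit using (⊤; tt)
open import Data.Vec using (tabulate)
open import Data.Vec.Properties using (lookup∘tabulate; lookup⇒[]=; []=⇒lookup)
open import Function using (_∘_; flip; _on_)
open import Function.Bundles using (mk⇔; Equivalence)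
open import Function.Definitions using (Injective)
open import Level using (0ℓ)
open import Relation.Binary using (Rel; Transitive; Trichotomous; IsStrictTotalOrder; tri<; tri≈; tri>)
open import Relation.Binary.PropositionalEquality
import Relation.Binary.Construct.Flip.EqAndOrd as Flip
open import Relation.Binary.Structures.Biased using (isStrictTotalOrderᶜ)
open import Relation.Nullary using (¬_; Dec; yes; no; does; recompute; contradiction; ¬?; _×-dec_)
open import Relation.Nullary.Decidable using (dec-true)

open Equivalence using (to; from)

-- Counting in finite sets, and the pigeonhole principle.

module _ {n} {P : Fin n → Set} (P? : ∀ i → Dec (P i)) where

  sep : Subset n
  sep = tabulate (does ∘ P?)

  ∈-sep⁺ : ∀ {i} → P i → i ∈ sep
  ∈-sep⁺ {i} p = lookup⇒[]= i sep (trans (lookup∘tabulate _ i) (dec-true (P? i) p))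

  ∈-sep⁻ : ∀ {i} → i ∈ sep → P i
  ∈-sep⁻ {i} i∈ with P? i | trans (sym (lookup∘tabulate (does ∘ P?) i)) ([]=⇒lookup i∈)
  ... | yes p | _ = p

  count : ℕ
  count = ∣ sep ∣

  count≤n : count ≤ n
  count≤n = ∣p∣≤n sep

module _ {n} {P Q : Fin n → Set} (P? : ∀ i → Dec (P i)) (Q? : ∀ i → Dec (Q i)) where

  count-mono : (∀ i → P i → Q i) → count P? ≤ count Q?
  count-mono P⇒Q = p⊆q⇒∣p∣≤∣q∣ (∈-sep⁺ Q? ∘ P⇒Q _ ∘ ∈-sep⁻ P?)

  count-mono-< : (∀ i → P i → Q i) → ∀ k → Q k → ¬ P k → count P? < count Q?
  count-mono-< P⇒Q k q ¬p =
    p⊂q⇒∣p∣<∣q∣ ((∈-sep⁺ Q? ∘ P⇒Q _ ∘ ∈-sep⁻ P?) , k , ∈-sep⁺ Q? q , ¬p ∘ ∈-sep⁻ P?)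

-- If `j` were missed, punching it out would inject `Fin (suc n)` into `Fin n`.
injective⇒surjective : ∀ {n} {f : Fin n → Fin n} → Injective _≡_ _≡_ f → ∀ j → ∃ λ i → f i ≡ j
injective⇒surjective {suc n} {f} inj j with any? (λ i → f i FP.≟ j)
... | yes hit = hit
... | no miss = contradiction (injective⇒≤ avoid-j-injective) (<⇒≱ (n<1+n n))
  where
  j≢f : ∀ i → j ≢ f i
  j≢f i eq = miss (i , sym eq)
  avoid-j-injective : Injective _≡_ _≡_ (λ i → punchOut (j≢f i))
  avoid-j-injective {x} {y} eq = inj (punchOut-injective (j≢f x) (j≢f y) eq)

-- Ranks in finite linear orders.

record Enumeration (P : Set) : Set where
  field
    size : ℕ
    pt : Fin size → P
    ix : P → Fin size
    pt-ix : ∀ p → pt (ix p) ≡ p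
    ix-pt : ∀ i → ix (pt i) ≡ i

module Ranking {P : Set} (E : Enumeration P) {_≺_ : P → P → Set}
               (sto : IsStrictTotalOrder _≡_ _≺_) where
  open Enumeration E
  open IsStrictTotalOrder sto using (compare) renaming (trans to ≺-trans; irrefl to ≺-irrefl; _<?_ to _≺?_)

  below? : ∀ p i → Dec (pt i ≺ p)
  below? p i = pt i ≺? p

  count<size : ∀ p → count (below? p) < size
  count<size p = <-≤-trans
    (count-mono-< (below? p) everything? _ (ix p) tt (≺-irrefl (pt-ix p)))
    (count≤n everything?)
    where
    everything? : ∀ (i : Fin size) → Dec ⊤
    everything? _ = yes tt

  rank : P → Fin size
  rank p = fromℕ< (count<size p)

  rank-mono : ∀ {p q} → p ≺ q → rank p F.< rank q
  rank-mono {p} {q} p≺q =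
    subst₂ _<_ (sym (toℕ-fromℕ< (count<size p))) (sym (toℕ-fromℕ< (count<size q)))
      (count-mono-< (below? p) (below? q) (λ i i≺p → ≺-trans i≺p p≺q) (ix p)
        (subst (_≺ q) (sym (pt-ix p)) p≺q) (≺-irrefl (pt-ix p)))

  rank-injective : ∀ {p q} → rank p ≡ rank q → p ≡ q
  rank-injective {p} {q} eq with compare p q
  ... | tri< p≺q _ _ = contradiction (rank-mono p≺q) (<-irrefl (cong toℕ eq))
  ... | tri≈ _ p≡q _ = p≡q
  ... | tri> _ _ q≺p = contradiction (rank-mono q≺p) (<-irrefl (cong toℕ (sym eq)))

  rank-cancel : ∀ {p q} → rank p F.< rank q → p ≺ q
  rank-cancel {p} {q} lt with compare p q
  ... | tri< p≺q _ _ = p≺q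
  ... | tri≈ _ refl _ = contradiction lt (<-irrefl refl)
  ... | tri> _ _ q≺p = contradiction (<-trans lt (rank-mono q≺p)) (<-irrefl refl)

  private
    hit : ∀ i → ∃ λ j → rank (pt j) ≡ i
    hit = injective⇒surjective λ {i} {j} eq →
      trans (sym (ix-pt i)) (trans (cong ix (rank-injective eq)) (ix-pt j))

  at : Fin size → P
  at i = pt (proj₁ (hit i))

  rank-at : ∀ i → rank (at i) ≡ i
  rank-at i = proj₂ (hit i)

  at-rank : ∀ p → at (rank p) ≡ p
  at-rank p = rank-injective (rank-at (rank p))

  at-mono : ∀ {i j} → i F.< j → at i ≺ at j
  at-mono {i} {j} lt = rank-cancel (subst₂ F._<_ (sym (rank-at i)) (sym (rank-at j)) lt)

-- Containment, and the permutation of a finite set with two linear orders.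

≼-intro : ∀ α β (h : Fin (len α) → Fin (len β)) → (∀ {i j} → i F.< j → h i F.< h j) →
          (∀ {i j} → fun α i F.< fun α j → fun β (h i) F.< fun β (h j)) → α ≼ β
≼-intro α β h mono order = h , (λ _ _ → mono) , λ i j → mk⇔ order (reflects i j)
  where
  -- The values of `α` are distinct and linearly ordered, so a map preserving their order also
  -- reflects it.
  reflects : ∀ i j → fun β (h i) F.< fun β (h j) → fun α i F.< fun α j
  reflects i j lt with FP.<-cmp (fun α i) (fun α j)
  ... | tri< a _ _ = a
  ... | tri≈ _ eq _ = contradiction lt (<-irrefl (cong (toℕ ∘ fun β ∘ h) (inj α eq)))
  ... | tri> _ _ c = contradiction lt (ℕ.<-asym (order c))

Convex : ∀ {P : Set} → (P → P → Set) → (P → Set) → Set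
Convex _≺_ S = ∀ {p q r} → S p → S r → p ≺ q → q ≺ r → S q

module Standardization {P : Set} (E : Enumeration P) {_≺_ _⋖_ : P → P → Set}
                       (≺-sto : IsStrictTotalOrder _≡_ _≺_) (⋖-sto : IsStrictTotalOrder _≡_ _⋖_) where
  open Enumeration E using (size)
  private
    module X = Ranking E ≺-sto
    module Y = Ranking E ⋖-sto

  std : Perm
  std = perm size (Y.rank ∘ X.at) λ {i} {j} eq →
    trans (sym (X.rank-at i)) (trans (cong X.rank (Y.rank-injective eq)) (X.rank-at j))

  ≼-std : ∀ α (h : Fin (len α) → P) → (∀ {i j} → i F.< j → h i ≺ h j) →
          (∀ {i j} → fun α i F.< fun α j → h i ⋖ h j) → α ≼ std
  ≼-std α h h-≺ h-⋖ = ≼-intro α std (X.rank ∘ h) (X.rank-mono ∘ h-≺) λ {i} {j} lt →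
    subst₂ (λ p q → Y.rank p F.< Y.rank q) (sym (X.at-rank (h i))) (sym (X.at-rank (h j)))
      (Y.rank-mono (h-⋖ lt))

  ≼-std⁻ : ∀ α → α ≼ std → ∃ λ (h : Fin (len α) → P) → (∀ i j → i F.< j → h i ≺ h j) ×
           (∀ i j → fun α i F.< fun α j → h i ⋖ h j)
  ≼-std⁻ α (f , mono , order) =
    X.at ∘ f , (λ i j lt → X.at-mono (mono i j lt)) , λ i j lt → Y.rank-cancel (to (order i j) lt)

  -- The points of an interval are cut out both by a window of columns and by a window of rows,
  -- hence are convex in both orders. If `a` and `b` differ, the points in these two columns are
  -- distinct, so the interval would be everything, which its definition excludes.
  simple-std : (∀ (S : P → Set) → Convex _≺_ S → Convex _⋖_ S →
                ∀ {p q} → p ≢ q → S p → S q → ∀ r → S r) →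
               Simple std
  simple-std only-trivial a b (a≤b , b<n , (c , window) , proper) with a ℕ.≟ b
  ... | yes a≡b = a≡b
  ... | no a≢b = contradiction (a≡0 , 1+b≡n) proper
    where
    S : P → Set
    S p = InWindow a b (X.rank p)

    height : P → ℕ
    height p = toℕ (Y.rank p)

    S⇒rows : ∀ {p} → S p → c ≤ height p × height p ≤ c + (b ∸ a)
    S⇒rows {p} s = from (window (Y.rank p)) (X.rank p , s , cong Y.rank (X.at-rank p))

    rows⇒S : ∀ {p} → c ≤ height p → height p ≤ c + (b ∸ a) → S p
    rows⇒S {p} l u with to (window (Y.rank p)) (l , u)
    ... | i , s , eq = subst (InWindow a b)
      (trans (sym (X.rank-at i)) (cong X.rank (Y.rank-injective eq))) s

    a<n : a < size
    a<n = ≤-<-trans a≤b b<n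

    S-at : ∀ {k} (k<n : k < size) → a ≤ k → k ≤ b → S (X.at (fromℕ< k<n))
    S-at k<n l u = subst (λ k → a ≤ k × k ≤ b)
      (sym (trans (cong toℕ (X.rank-at (fromℕ< k<n))) (toℕ-fromℕ< k<n))) (l , u)

    everything : ∀ r → S r
    everything = only-trivial S
      (λ (l , _) (_ , u) p≺q q≺r →
        ≤-trans l (<⇒≤ (X.rank-mono p≺q)) , ≤-trans (<⇒≤ (X.rank-mono q≺r)) u)
      (λ s t p⋖q q⋖r → rows⇒S
        (≤-trans (proj₁ (S⇒rows s)) (<⇒≤ (Y.rank-mono p⋖q)))
        (≤-trans (<⇒≤ (Y.rank-mono q⋖r)) (proj₂ (S⇒rows t))))
      {X.at (fromℕ< a<n)} {X.at (fromℕ< b<n)}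
      (λ eq → a≢b (trans (sym (toℕ-fromℕ< a<n)) (trans (cong toℕ
        (trans (sym (X.rank-at _)) (trans (cong X.rank eq) (X.rank-at _)))) (toℕ-fromℕ< b<n))))
      (S-at a<n ℕ.≤-refl a≤b) (S-at b<n a≤b ℕ.≤-refl)

    S-all : ∀ {k} (k<n : k < size) → a ≤ k × k ≤ b
    S-all k<n = subst (λ k → a ≤ k × k ≤ b)
      (trans (cong toℕ (X.rank-at (fromℕ< k<n))) (toℕ-fromℕ< k<n)) (everything (X.at (fromℕ< k<n)))

    a≡0 : a ≡ 0
    a≡0 = ℕ.n≤0⇒n≡0 (proj₁ (S-all (≤-<-trans z≤n b<n)))

    1+b≡n : suc b ≡ size
    1+b≡n with ℕ.m≤n⇒m<n∨m≡n b<n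
    ... | inj₂ eq = eq
    ... | inj₁ lt = contradiction (proj₂ (S-all lt)) (<⇒≱ (n<1+n b))

-- The lexicographic order on pairs of a time and a slot within it.

_<ₗ_ : Rel (ℕ × ℕ) 0ℓ
_<ₗ_ = ×-Lex _≡_ _<_ _<_

<ₗ-trans : Transitive _<ₗ_
<ₗ-trans {i} {j} {k} = ×-transitive {_<₂_ = _<_} isEquivalence (resp₂ _<_) <-trans <-trans {i} {j} {k}

<ₗ-irrefl : ∀ {x} → ¬ (x <ₗ x)
<ₗ-irrefl (inj₁ lt) = <-irrefl refl lt
<ₗ-irrefl (inj₂ (_ , lt)) = <-irrefl refl lt

<ₗ-weak : ∀ {a b i j} → i < j → a ≤ b → (a , i) <ₗ (b , j)
<ₗ-weak i<j a≤b with ℕ.m≤n⇒m<n∨m≡n a≤b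
... | inj₁ a<b = inj₁ a<b
... | inj₂ a≡b = inj₂ (a≡b , i<j)

<ₗ⇒≤ : ∀ {a b i j} → (a , i) <ₗ (b , j) → a ≤ b
<ₗ⇒≤ (inj₁ a<b) = <⇒≤ a<b
<ₗ⇒≤ (inj₂ (a≡b , _)) = ≤-reflexive a≡b

<ₗ⇒< : ∀ {a b i j} → j ≤ i → (a , i) <ₗ (b , j) → a < b
<ₗ⇒< j≤i (inj₁ a<b) = a<b
<ₗ⇒< j≤i (inj₂ (_ , i<j)) = contradiction j≤i (<⇒≱ i<j)

-- Used to show that nothing separates a `w` from the adjacent `q` in one of the two orders.
<ₗ-gap : ∀ {t i x} → (t , i) <ₗ x → ¬ (x <ₗ (t , suc i))
<ₗ-gap (inj₁ t<a) (inj₁ a<t) = ℕ.<-asym t<a a<t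
<ₗ-gap (inj₁ t<a) (inj₂ (refl , _)) = <-irrefl refl t<a
<ₗ-gap (inj₂ (refl , _)) (inj₁ a<t) = <-irrefl refl a<t
<ₗ-gap (inj₂ (_ , i<b)) (inj₂ (_ , b≤i)) = <⇒≱ i<b (ℕ.≤-pred b≤i)

<ₗ-on-sto : ∀ {P : Set} {key : P → ℕ × ℕ} → Injective _≡_ _≡_ key →
            IsStrictTotalOrder _≡_ (_<ₗ_ on key)
<ₗ-on-sto {key = key} key-inj = isStrictTotalOrderᶜ record
  { isEquivalence = isEquivalence ; trans = <ₗ-trans ; compare = compare }
  where
  compare : Trichotomous _≡_ (_<ₗ_ on key)
  compare p q with ×-compare sym <-cmp <-cmp (key p) (key q)
  ... | tri< a ¬b ¬c = tri< a (λ { refl → <ₗ-irrefl a }) ¬c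
  ... | tri≈ ¬a (b , b′) ¬c = tri≈ ¬a (key-inj (cong₂ _,_ b b′)) ¬c
  ... | tri> ¬a ¬b c = tri> ¬a (λ { refl → <ₗ-irrefl c }) c

-- The bounds stored in `q` and `w` are irrelevant, so that these points are determined by their
-- index; decidability recovers the bounds.
relevant : ∀ {i j} → .(i < j) → i < j
relevant {i} {j} = recompute (i <? j)

-- The extended diagram: its points and their two orders.

module Staircase {m} (R C : Fin m → ℕ) (T : ℕ) (2≤T : 2 ≤ T)
                 (R-inj : Injective _≡_ _≡_ R) (C-inj : Injective _≡_ _≡_ C)
                 (3+R≤C : ∀ j → 3 + R j ≤ C j) (C<T : ∀ j → C j < T) where

  -- X is the horizontal coordinate and Y the vertical one, growing downwards.  Between q t and
  -- q (t + 1) come, in this order, the column of w (t - 1), an entry's column or row, and the row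
  -- of w (t + 1).
  data Pt : Set where
    q : ∀ t → .(t < suc T) → Pt
    w : ∀ s → .(s < T) → Pt
    e : Fin m → Pt

  X Y : Pt → ℕ × ℕ
  X (q t _) = t , 1
  X (w s _) = suc s , 2
  X (e j) = C j , 3
  Y (q t _) = t , 1
  Y (w s _) = s , 0
  Y (e j) = R j , 3

  _≺_ _⋖_ : Pt → Pt → Set
  _≺_ = _<ₗ_ on X
  _⋖_ = flip (_<ₗ_ on Y)

  -- The slots differ between the three kinds of points, so a tie can only occur within one kind.
  X-injective : Injective _≡_ _≡_ X
  X-injective {q _ _} {q _ _} refl = refl
  X-injective {w _ _} {w _ _} refl = refl
  X-injective {e _} {e _} eq = cong e (C-inj (cong proj₁ eq))
  X-injective {q _ _} {w _ _} ()
  X-injective {q _ _} {e _} ()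
  X-injective {w _ _} {q _ _} ()
  X-injective {w _ _} {e _} ()
  X-injective {e _} {q _ _} ()
  X-injective {e _} {w _ _} ()

  Y-injective : Injective _≡_ _≡_ Y
  Y-injective {q _ _} {q _ _} refl = refl
  Y-injective {w _ _} {w _ _} refl = refl
  Y-injective {e _} {e _} eq = cong e (R-inj (cong proj₁ eq))
  Y-injective {q _ _} {w _ _} ()
  Y-injective {q _ _} {e _} ()
  Y-injective {w _ _} {q _ _} ()
  Y-injective {w _ _} {e _} ()
  Y-injective {e _} {q _ _} ()
  Y-injective {e _} {w _ _} ()

  enumeration : Enumeration Pt
  enumeration = record
    { size = suc T + (T + m) ; pt = pt ; ix = ix ; pt-ix = pt-ix ; ix-pt = ix-pt }
    where
    label : Fin (suc T) ⊎ (Fin T ⊎ Fin m) → Pt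
    label (inj₁ i) = q (toℕ i) (toℕ<n i)
    label (inj₂ (inj₁ i)) = w (toℕ i) (toℕ<n i)
    label (inj₂ (inj₂ j)) = e j

    unlabel : Pt → Fin (suc T) ⊎ (Fin T ⊎ Fin m)
    unlabel (q t t≤T) = inj₁ (fromℕ< t≤T)
    unlabel (w s s<T) = inj₂ (inj₁ (fromℕ< s<T))
    unlabel (e j) = inj₂ (inj₂ j)

    label-unlabel : ∀ p → label (unlabel p) ≡ p
    label-unlabel (q t t≤T) = X-injective (cong (_, 1) (toℕ-fromℕ< t≤T))
    label-unlabel (w s s<T) = Y-injective (cong (_, 0) (toℕ-fromℕ< s<T))
    label-unlabel (e j) = refl

    unlabel-label : ∀ i → unlabel (label i) ≡ i
    unlabel-label (inj₁ i) = cong inj₁ (fromℕ<-toℕ i _)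
    unlabel-label (inj₂ (inj₁ i)) = cong (inj₂ ∘ inj₁) (fromℕ<-toℕ i _)
    unlabel-label (inj₂ (inj₂ j)) = refl

    split : Fin (suc T + (T + m)) → Fin (suc T) ⊎ (Fin T ⊎ Fin m)
    split i = Sum.map₂ (splitAt T) (splitAt (suc T) i)

    unsplit : Fin (suc T) ⊎ (Fin T ⊎ Fin m) → Fin (suc T + (T + m))
    unsplit i = join (suc T) (T + m) (Sum.map₂ (join T m) i)

    split-unsplit : ∀ i → split (unsplit i) ≡ i
    split-unsplit i rewrite splitAt-join (suc T) (T + m) (Sum.map₂ (join T m) i) with i
    ... | inj₁ _ = refl
    ... | inj₂ j = cong inj₂ (splitAt-join T m j)

    unsplit-split : ∀ i → unsplit (split i) ≡ i
    unsplit-split i = trans (cong (join (suc T) (T + m)) (collapse (splitAt (suc T) i)))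
                            (join-splitAt (suc T) (T + m) i)
      where
      collapse : ∀ x → Sum.map₂ (join T m) (Sum.map₂ (splitAt T) x) ≡ x
      collapse (inj₁ _) = refl
      collapse (inj₂ j) = cong inj₂ (join-splitAt T m j)

    pt : Fin (suc T + (T + m)) → Pt
    pt = label ∘ split

    ix : Pt → Fin (suc T + (T + m))
    ix = unsplit ∘ unlabel

    pt-ix : ∀ p → pt (ix p) ≡ p
    pt-ix p = trans (cong label (split-unsplit (unlabel p))) (label-unlabel p)

    ix-pt : ∀ i → ix (pt i) ≡ i
    ix-pt i = trans (cong unsplit (unlabel-label (split i))) (unsplit-split i)

  open Standardization enumeration (<ₗ-on-sto X-injective) (Flip.isStrictTotalOrder (<ₗ-on-sto Y-injective)) public

  -- Simplicity: sets convex in both orders.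

  module Blocks {S : Pt → Set} (convex-X : Convex _≺_ S) (convex-Y : Convex _⋖_ S) where

    Q : ℕ → Set
    Q t = Σ (t < suc T) λ t≤T → S (q t t≤T)

    TwoSteps : Set
    TwoSteps = ∃ λ t → Q t × Q (suc t)

    q-q : ∀ {i j} → i < j → Q i → Q j → TwoSteps
    q-q {i} {j} i<j Qi@(_ , si) Qj@(j≤T , sj) with ℕ.m≤n⇒m<n∨m≡n i<j
    ... | inj₂ refl = i , Qi , Qj
    ... | inj₁ 1+i<j = i , Qi , (<-trans 1+i<j j≤T , convex-X si sj (inj₁ (n<1+n i)) (inj₁ 1+i<j))

    -- If `s < i`, the row of `q s` lies between those of `w s` and `q i`; otherwise the column of
    -- `q (suc s)` lies between those of `q i` and `w s`.
    q-w : ∀ {i s} .{s<T} → Q i → S (w s s<T) → s < T → TwoSteps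
    q-w {i} {s} Qi@(_ , si) sw s<T with ℕ.<-≤-connex s i
    ... | inj₁ s<i = q-q s<i
      (<-trans s<T (n<1+n T) , convex-Y si sw (inj₁ s<i) (<ₗ-weak (s≤s z≤n) ℕ.≤-refl)) Qi
    ... | inj₂ i≤s = q-q (s≤s i≤s) Qi
      (s≤s s<T , convex-X si sw (inj₁ (s≤s i≤s)) (<ₗ-weak ℕ.≤-refl ℕ.≤-refl))

    C≤T : ∀ j → C j < suc T
    C≤T j = <-trans (C<T j) (n<1+n T)

    1+R<C : ∀ j → suc (R j) < C j
    1+R<C j = <-trans (n<1+n _) (3+R≤C j)

    -- The arc of `e j` straddles `q (suc (R j))` up to `q (C j)`. The last of these lies
    -- horizontally between `q i` and `e j` if `i < C j`; otherwise the first lies between them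
    -- vertically.
    q-e : ∀ {i j} → Q i → S (e j) → TwoSteps
    q-e {i} {j} Qi@(_ , si) se with ℕ.<-≤-connex i (C j)
    ... | inj₁ i<C = q-q i<C Qi
      (C≤T j , convex-X si se (inj₁ i<C) (<ₗ-weak (s≤s (s≤s z≤n)) ℕ.≤-refl))
    ... | inj₂ C≤i = q-q 1+R<i
      (<-trans (1+R<C j) (C≤T j) , convex-Y si se (inj₁ 1+R<i) (inj₁ (n<1+n _))) Qi
      where
      1+R<i : suc (R j) < i
      1+R<i = <-≤-trans (1+R<C j) C≤i

    w-w : ∀ {s s′} .{s<T} .{s′<T} → s < s′ → s′ < T → S (w s s<T) → S (w s′ s′<T) → TwoSteps
    w-w {s} {s′} s<s′ s′<T sw sw′ = q-w {i = suc s′}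
      (s≤s s′<T , convex-X sw sw′ (inj₁ (s≤s s<s′)) (<ₗ-weak ℕ.≤-refl ℕ.≤-refl)) sw′ s′<T

    w-e : ∀ {s j} .{s<T} → s < T → S (w s s<T) → S (e j) → TwoSteps
    w-e {s} {j} s<T sw se with <-cmp (suc s) (C j)
    ... | tri< 1+s<C _ _ =
      q-e (C≤T j , convex-X sw se (inj₁ 1+s<C) (<ₗ-weak (s≤s (s≤s z≤n)) ℕ.≤-refl)) se
    -- The two columns are adjacent here, so the separating `q` must come from the rows;
    -- `3 + R j ≤ C j` leaves room for `q (suc (R j))`.
    ... | tri≈ _ 1+s≡C _ =
      q-e (<-trans (1+R<C j) (C≤T j) , convex-Y sw se (inj₁ 1+R<s) (inj₁ (n<1+n _))) se
      where
      1+R<s : suc (R j) < s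
      1+R<s = ℕ.≤-pred (subst (3 + R j ≤_) (sym 1+s≡C) (3+R≤C j))
    ... | tri> _ _ C<1+s =
      q-w {i = suc s} (s≤s s<T , convex-X se sw (inj₁ C<1+s) (<ₗ-weak ℕ.≤-refl ℕ.≤-refl)) sw s<T

    e-e : ∀ {j j′} → C j < C j′ → S (e j) → S (e j′) → TwoSteps
    e-e {j} {j′} lt se se′ =
      q-e (C≤T j′ , convex-X se se′ (inj₁ lt) (<ₗ-weak (s≤s (s≤s z≤n)) ℕ.≤-refl)) se′

    -- Unless both points are q's, some further q lies between them, horizontally or vertically.
    two-steps : ∀ {p r} → p ≺ r → S p → S r → TwoSteps
    two-steps {q i i≤T} {q j j≤T} lt sp sr =
      q-q (<ₗ⇒< ℕ.≤-refl lt) (relevant i≤T , sp) (relevant j≤T , sr)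
    two-steps {q i i≤T} {w s s<T} _ sp sr = q-w (relevant i≤T , sp) sr (relevant s<T)
    two-steps {q i i≤T} {e j} _ sp sr = q-e (relevant i≤T , sp) sr
    two-steps {w s s<T} {q i i≤T} _ sp sr = q-w (relevant i≤T , sr) sp (relevant s<T)
    two-steps {w s s<T} {w s′ s′<T} lt sp sr =
      w-w (ℕ.≤-pred (<ₗ⇒< ℕ.≤-refl lt)) (relevant s′<T) sp sr
    two-steps {w s s<T} {e j} _ sp sr = w-e (relevant s<T) sp sr
    two-steps {e j} {q i i≤T} _ sp sr = q-e (relevant i≤T , sr) sp
    two-steps {e j} {w s s<T} _ sp sr = w-e (relevant s<T) sr sp
    two-steps {e j} {e j′} lt sp sr = e-e (<ₗ⇒< ℕ.≤-refl lt) sp sr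

    -- The column of `w s` lies between those of `q (suc s)` and `q (2 + s)`, and then the row of
    -- `q s` lies between those of `w s` and `q (suc s)`.
    down : ∀ t → Q t → Q (suc t) → Q 0 × Q 1
    down zero Q₀ Q₁ = Q₀ , Q₁
    down (suc s) Q₁@(1+s≤T , s₁) (2+s≤T , s₂) = down s Qs Q₁
      where
      s<T : s < T
      s<T = ℕ.≤-pred 1+s≤T
      s-w : S (w s s<T)
      s-w = convex-X s₁ s₂ (<ₗ-weak ℕ.≤-refl ℕ.≤-refl) (inj₁ (n<1+n _))
      Qs : Q s
      Qs = <-trans s<T (n<1+n T) ,
           convex-Y s₁ s-w (inj₁ (n<1+n s)) (<ₗ-weak ℕ.≤-refl ℕ.≤-refl)

    w-low : ∀ {u} → Q u → Q (suc u) → (1+u<T : suc u < T) → S (w (suc u) 1+u<T)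
    w-low (_ , s₀) (_ , s₁) _ = convex-Y s₁ s₀ (<ₗ-weak ℕ.≤-refl ℕ.≤-refl) (inj₁ (n<1+n _))

    -- The chain is followed the other way: `w (suc u)` is caught by its row, and then `q (2 + u)`
    -- by its column. The induction starts from the pair that `down` reaches.
    up : TwoSteps → ∀ t → t < T → Q t × Q (suc t)
    up (t₀ , Q₀ , Q₁) zero _ = down t₀ Q₀ Q₁
    up start (suc u) 1+u<T with up start u (<-trans (n<1+n u) 1+u<T)
    ... | Qu , Q₁@(_ , s₁) = Q₁ ,
      (s≤s 1+u<T , convex-X s₁ (w-low Qu Q₁ 1+u<T) (inj₁ (n<1+n _)) (<ₗ-weak ℕ.≤-refl ℕ.≤-refl))

    everything : TwoSteps → ∀ r → S r
    everything start = all
      where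
      steps : ∀ t → t < T → Q t × Q (suc t)
      steps = up start

      0<T : 0 < T
      0<T = <-trans (n<1+n 0) 2≤T

      all-q : ∀ t .(t<1+T : t < suc T) → S (q t t<1+T)
      all-q zero _ = proj₂ (proj₁ (steps 0 0<T))
      all-q (suc t) t<T = proj₂ (proj₂ (steps t (ℕ.≤-pred (relevant t<T))))

      all : ∀ r → S r
      all (q t t<1+T) = all-q t t<1+T
      -- The row of `w zero` is above every `q`, so this point is caught by its column, between
      -- `q 1` and `q 2`; hence the need for `2 ≤ T`.
      all (w zero _) =
        convex-X (proj₂ (proj₁ (steps 1 2≤T))) (proj₂ (proj₂ (steps 1 2≤T)))
          (<ₗ-weak ℕ.≤-refl ℕ.≤-refl) (inj₁ (n<1+n _))
      all (w (suc u) u<T) = w-low (proj₁ (steps u u<)) (proj₂ (steps u u<)) (relevant u<T)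
        where
        u< : u < T
        u< = <-trans (n<1+n u) (relevant u<T)
      all (e j) = convex-X (all-q 0 (s≤s z≤n)) (all-q T (n<1+n T))
        (<ₗ-weak (s≤s (s≤s z≤n)) z≤n) (inj₁ (C<T j))

  std-simple : Simple std
  std-simple = simple-std λ S convex-X convex-Y {p} {r} p≢r sp sr →
    let open Blocks (λ {p} {q} {r} → convex-X {p} {q} {r}) (λ {p} {q} {r} → convex-Y {p} {q} {r}) in
    everything ([ (λ p≺r → two-steps p≺r sp sr) , (λ r≺p → two-steps r≺p sr sp) ]′ (connex p≢r))
    where
    connex : ∀ {p r} → p ≢ r → p ≺ r ⊎ r ≺ p
    connex {p} {r} p≢r with IsStrictTotalOrder.compare (<ₗ-on-sto X-injective) p r
    ... | tri< a _ _ = inj₁ a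
    ... | tri≈ _ b _ = contradiction b p≢r
    ... | tri> _ _ c = inj₂ c

  -- Points to the upper right of a diagonal point.

  Straddles : ℕ → Pt → Set
  Straddles t r = (t , 1) <ₗ X r × Y r <ₗ (t , 1)

  -- A left-to-right minimum weakly to the lower left of the given point.
  guard : Pt → ℕ
  guard (q t _) = t
  guard (w s _) = s
  guard (e j) = C j

  -- By transitivity, since `p` either is the `q` at its guard or straddles it. This lets a `q` take
  -- over the role of the entry 1 in an occurrence.
  above⇒straddles : ∀ p r → p ≺ r → p ⋖ r → Straddles (guard p) r
  above⇒straddles (q t _) r x y = x , y
  above⇒straddles (w s s<T) r x y =
    <ₗ-trans {j = X (w s s<T)} {k = X r} (inj₁ (n<1+n s)) x ,
    <ₗ-trans {i = Y r} {j = Y (w s s<T)} y (<ₗ-weak ℕ.≤-refl ℕ.≤-refl)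
  above⇒straddles (e j) r x y =
    <ₗ-trans {j = X (e j)} {k = X r} (<ₗ-weak (s≤s (s≤s z≤n)) ℕ.≤-refl) x ,
    <ₗ-trans {i = Y r} {j = Y (e j)} y (inj₁ (<-trans (n<1+n _) (<-trans (n<1+n _) (3+R≤C j))))

  -- The column of `w s` comes immediately after that of `q (suc s)`, and the row of `w t` lies
  -- immediately above that of `q t`; the constructors are named accordingly.
  data Straddler : ℕ → Pt → Set where
    arc : ∀ {t j} → Straddler t (e j)
    leftmost : ∀ {s} .{s<T} → Straddler (suc s) (w s s<T)
    lowest : ∀ {t} .{t<T} → Straddler t (w t t<T)

  straddler : ∀ {t} r → Straddles t r → Straddler t r
  straddler (q t′ _) (x , y) = contradiction (<ₗ-trans {j = t′ , 1} x y) <ₗ-irrefl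
  straddler {t} (w s _) (x , y) with ℕ.m≤n⇒m<n∨m≡n (<ₗ⇒≤ x) | <ₗ⇒≤ y
  ... | inj₂ refl | _ = leftmost
  ... | inj₁ t<1+s | s≤t with ℕ.≤-antisym s≤t (ℕ.≤-pred t<1+s)
  ... | refl = lowest
  straddler (e j) _ = arc

  Arc : Pt → Set
  Arc r = ∃ λ j → r ≡ e j

  -- `a` to the left of `b` excludes `leftmost`, and `d` below `b` excludes `lowest`. In an
  -- occurrence, `a` and `d` play n and 2.
  inner-arc : ∀ {t} a b d → Straddles t a → Straddles t b → Straddles t d → a ≺ b → d ⋖ b → Arc b
  inner-arc a b d (t<a , _) sb (_ , d<t) a≺b d⋖b with b | straddler b sb
  ... | .(e _) | arc = _ , refl
  ... | .(w _ _) | leftmost = contradiction a≺b (<ₗ-gap {x = X a} t<a)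
  ... | .(w _ _) | lowest = contradiction d<t (<ₗ-gap {x = Y d} d⋖b)

  -- For the entry n. If `a` were the leftmost `w s`, with `t` equal to `suc s`, both arcs below it
  -- would have their row crossed at time `s`, against injectivity of `R`.
  first-arc : ∀ {t} a {j k} → Straddles t a → Straddles t (e j) → Straddles t (e k) → j ≢ k →
              e j ⋖ a → e k ⋖ a → Arc a
  first-arc a {j} {k} sa (_ , j<t) (_ , k<t) j≢k j⋖a k⋖a with a | straddler a sa
  ... | .(e _) | arc = _ , refl
  ... | .(w _ _) | lowest = contradiction j<t (<ₗ-gap {x = Y (e j)} j⋖a)
  ... | .(w _ _) | leftmost = contradiction (R-inj (trans (pinned j⋖a j<t) (sym (pinned k⋖a k<t)))) j≢k
    where
    pinned : ∀ {s r} → (s , 0) <ₗ (r , 3) → (r , 3) <ₗ (suc s , 1) → r ≡ s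
    pinned lo hi = ℕ.≤-antisym (ℕ.≤-pred (<ₗ⇒< (s≤s z≤n) hi)) (<ₗ⇒≤ lo)

  -- The dual argument for the entry 2: two arcs to the left of the lowest `w t` would both have
  -- their column crossed at time `t`.
  last-arc : ∀ {t} d {j k} → Straddles t d → Straddles t (e j) → Straddles t (e k) → j ≢ k →
             e j ≺ d → e k ≺ d → Arc d
  last-arc d {j} {k} sd (t<j , _) (t<k , _) j≢k j≺d k≺d with d | straddler d sd
  ... | .(e _) | arc = _ , refl
  ... | .(w _ _) | leftmost = contradiction j≺d (<ₗ-gap {x = X (e j)} t<j)
  ... | .(w _ _) | lowest = contradiction (C-inj (trans (pinned t<j j≺d) (sym (pinned t<k k≺d)))) j≢k
    where
    pinned : ∀ {t c} → (t , 1) <ₗ (c , 3) → (c , 3) <ₗ (suc t , 2) → c ≡ t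
    pinned lo hi = ℕ.≤-antisym (ℕ.≤-pred (<ₗ⇒< (s≤s (s≤s z≤n)) hi)) (<ₗ⇒≤ lo)

-- Patterns 1 n ... 2 of length at least five.

module OneNTwo {k} {f : Fin (5 + k) → Fin (5 + k)} (f-inj : Injective _≡_ _≡_ f)
               (form : FormOneNTwo (perm (5 + k) f f-inj)) where

  π : Perm
  π = perm (5 + k) f f-inj

  last : Fin (5 + k)
  last = fromℕ (4 + k)

  f-first : toℕ (f zero) ≡ 0
  f-first = proj₁ form zero refl

  f-second : toℕ (f (suc zero)) ≡ 4 + k
  f-second = proj₁ (proj₂ form) (suc zero) refl

  f-last : toℕ (f last) ≡ 1
  f-last = proj₂ (proj₂ form) last (toℕ-fromℕ (4 + k))

  f-first-min : ∀ {i} → f zero F.≤ f i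
  f-first-min {i} = subst (_≤ toℕ (f i)) (sym f-first) z≤n

  f-nonzero : ∀ i → 0 < toℕ (f (suc i))
  f-nonzero i = ℕ.n≢0⇒n>0 λ eq →
    contradiction (f-inj {suc i} {zero} (toℕ-injective (trans eq (sym f-first)))) λ ()

  f-last-min : ∀ i → f last F.≤ f (suc i)
  f-last-min i = subst (_≤ toℕ (f (suc i))) (sym f-last) (f-nonzero i)

  last-< : ∀ {i} → suc i ≢ last → f last F.< f (suc i)
  last-< {i} i≢last = ℕ.≤∧≢⇒< (f-last-min i) λ eq → i≢last (f-inj (toℕ-injective (sym eq)))

  <-second : ∀ {i} → i ≢ suc zero → f i F.< f (suc zero)
  <-second {i} i≢1 = ℕ.≤∧≢⇒<
    (subst (toℕ (f i) ≤_) (sym f-second) (ℕ.≤-pred (toℕ<n (f i))))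
    λ eq → i≢1 (f-inj (toℕ-injective eq))

  <-last : ∀ {i} → i ≢ last → i F.< last
  <-last {i} i≢last = ℕ.≤∧≢⇒< (FP.≤fromℕ i) (i≢last ∘ toℕ-injective)

  -- Among the entries of π other than 1, n is the leftmost and 2 the lowest, so a point left of the
  -- image of n and below that of 2 can serve as the entry 1.
  ≼-from-corner : ∀ σ (entry : Fin (4 + k) → Fin (len σ)) →
                  (∀ i j → i F.< j → entry i F.< entry j) →
                  (∀ i j → f (suc i) F.< f (suc j) → fun σ (entry i) F.< fun σ (entry j)) →
                  ∀ z → z F.< entry zero → fun σ z F.< fun σ (entry (fromℕ (3 + k))) → π ≼ σ
  ≼-from-corner σ entry mono order z z<first σz<σlast = ≼-intro π σ g (g-mono _ _) (g-order _ _)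
    where
    g : Fin (5 + k) → Fin (len σ)
    g zero = z
    g (suc i) = entry i

    g-mono : ∀ i j → i F.< j → g i F.< g j
    g-mono zero (suc zero) _ = z<first
    g-mono zero (suc (suc j)) _ = <-trans z<first (mono zero (suc j) (s≤s z≤n))
    g-mono (suc i) (suc j) lt = mono i j (ℕ.≤-pred lt)

    g-order : ∀ i j → f i F.< f j → fun σ (g i) F.< fun σ (g j)
    g-order i zero lt = contradiction (f-first-min {i}) (<⇒≱ lt)
    g-order zero (suc j) _ with suc j FP.≟ last
    ... | yes refl = σz<σlast
    ... | no j≢last = <-trans σz<σlast (order (fromℕ (3 + k)) j (last-< j≢last))
    g-order (suc i) (suc j) lt = order i j lt

-- Crossing times along the lower-left boundary of σ.

record Schedule (σ : Perm) : Set where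
  field
    R C : Fin (len σ) → ℕ
    T : ℕ
    C-mono : ∀ {j k} → j F.< k → C j < C k
    R-anti : ∀ {j k} → fun σ k F.< fun σ j → R j < R k
    3+R≤C : ∀ j → 3 + R j ≤ C j
    2≤T : 2 ≤ T
    C<T : ∀ j → C j < T
    -- This supplies the entry 1 once all other entries of an occurrence are known to be arcs
    -- straddling a common time.
    lower-left : ∀ {j k} → j F.< k → fun σ k F.< fun σ j → R k < C j →
                 ∃ λ z → z F.< j × fun σ z F.< fun σ k

module Times (σ : Perm) where

  -- Column i or row v is crossed once all rows or columns that must precede it are: row v comes
  -- before column i iff Covers i v.
  Covers : Fin (len σ) → Fin (len σ) → Set
  Covers i v = ∃ λ i′ → i′ F.≤ i × fun σ i′ F.≤ v

  covers? : ∀ i v → Dec (Covers i v)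
  covers? i v = any? λ i′ → (i′ FP.≤? i) ×-dec (fun σ i′ FP.≤? v)

  left-of? : ∀ (j i : Fin (len σ)) → Dec (i F.< j)
  left-of? j i = i FP.<? j

  above? : ∀ j (v : Fin (len σ)) → Dec (fun σ j F.< v)
  above? j v = fun σ j FP.<? v

  uncovered? : ∀ j i → Dec (¬ Covers i (fun σ j))
  uncovered? j i = ¬? (covers? i (fun σ j))

  -- Each sum counts the columns, then the rows, that the path crosses earlier.
  colTime rowTime : Fin (len σ) → ℕ
  colTime j = count (left-of? j) + count (covers? j)
  rowTime j = count (uncovered? j) + count (above? j)

  colTime-mono : ∀ {j k} → j F.< k → colTime j < colTime k
  colTime-mono {j} {k} j<k = ℕ.+-mono-<-≤
    (count-mono-< (left-of? j) (left-of? k) (λ i i<j → <-trans i<j j<k) j j<k (<-irrefl refl))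
    (count-mono (covers? j) (covers? k) λ v (i , i≤j , c) → i , ≤-trans i≤j (<⇒≤ j<k) , c)

  rowTime-anti : ∀ {j k} → fun σ k F.< fun σ j → rowTime j < rowTime k
  rowTime-anti {j} {k} lt = ℕ.+-mono-≤-<
    (count-mono (uncovered? j) (uncovered? k) λ i ¬c (i′ , i′≤i , c) →
      ¬c (i′ , i′≤i , ≤-trans c (<⇒≤ lt)))
    (count-mono-< (above? j) (above? k) (λ v → <-trans lt) (fun σ j) lt (<-irrefl refl))

  -- Entry `j` makes its column cover its own row, so whatever precedes the row also precedes the
  -- column; the row itself makes the inequality strict.
  rowTime<colTime : ∀ j → rowTime j < colTime j
  rowTime<colTime j = ℕ.+-mono-≤-<
    (count-mono (uncovered? j) (left-of? j) λ i ¬c → ℕ.≰⇒> λ j≤i → ¬c (j , j≤i , ℕ.≤-refl))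
    (count-mono-< (above? j) (covers? j) (λ v lt → j , ℕ.≤-refl , <⇒≤ lt)
      (fun σ j) (j , ℕ.≤-refl , ℕ.≤-refl) (<-irrefl refl))

  colTime≤ : ∀ j → colTime j ≤ len σ + len σ
  colTime≤ j = ℕ.+-mono-≤ (count≤n (left-of? j)) (count≤n (covers? j))

  -- If no entry is to the lower left of both j and k, the path passes column j before row k.
  lower-left : ∀ {j k} → j F.< k → fun σ k F.< fun σ j → rowTime k < colTime j →
               ∃ λ z → z F.< j × fun σ z F.< fun σ k
  lower-left {j} {k} j<k σk<σj lt with any? (λ z → (z FP.<? j) ×-dec (fun σ z FP.<? fun σ k))
  ... | yes found = found
  ... | no none = contradiction lt (ℕ.≤⇒≯ (ℕ.+-mono-≤
    (count-mono (left-of? j) (uncovered? k) λ i i<j (i′ , i′≤i , c) →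
      <⇒≱ (high (<⇒≤ (≤-<-trans i′≤i i<j))) c)
    (count-mono (covers? j) (above? k) λ v (i , i≤j , c) → <-≤-trans (high i≤j) c)))
    where
    high : ∀ {i} → i F.≤ j → fun σ k F.< fun σ i
    high {i} i≤j with FP.<-cmp (fun σ k) (fun σ i)
    ... | tri< a _ _ = a
    ... | tri≈ _ eq _ = contradiction (≤-<-trans i≤j j<k) (<-irrefl (cong toℕ (sym (inj σ eq))))
    ... | tri> _ _ c with ℕ.m≤n⇒m<n∨m≡n i≤j
    ...   | inj₁ i<j = contradiction (i , i<j , c) none
    ...   | inj₂ i≡j = contradiction c
      (ℕ.<-asym (subst (λ i → fun σ k F.< fun σ i) (sym (toℕ-injective i≡j)) σk<σj))

  -- Scaling by 3 makes every entry straddle at least three q's; one straddling just two could form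
  -- an interval with a w.
  schedule : Schedule σ
  schedule = record
    { R = λ j → 3 * rowTime j
    ; C = λ j → 3 * colTime j
    ; T = 2 + 3 * (len σ + len σ)
    ; C-mono = λ {j} {k} lt → ℕ.*-monoʳ-< 3 {colTime j} {colTime k} (colTime-mono lt)
    ; R-anti = λ {j} {k} lt → ℕ.*-monoʳ-< 3 {rowTime j} {rowTime k} (rowTime-anti lt)
    ; 3+R≤C = λ j → subst (_≤ 3 * colTime j) (ℕ.*-suc 3 (rowTime j)) (ℕ.*-monoʳ-≤ 3 (rowTime<colTime j))
    ; 2≤T = m≤m+n 2 _
    ; C<T = λ j → s≤s (ℕ.m≤n⇒m≤1+n (ℕ.*-monoʳ-≤ 3 (colTime≤ j)))
    ; lower-left = λ {j} {k} j<k σk<σj lt →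
        lower-left j<k σk<σj (ℕ.*-cancelˡ-< 3 (rowTime k) (colTime j) lt)
    }

-- The extension of σ given by a schedule.

module Extension {σ : Perm} (s : Schedule σ) where
  open Schedule s

  C-cancel : ∀ {j k} → C j < C k → j F.< k
  C-cancel {j} {k} lt with FP.<-cmp j k
  ... | tri< a _ _ = a
  ... | tri≈ _ refl _ = contradiction lt (<-irrefl refl)
  ... | tri> _ _ c = contradiction lt (ℕ.<-asym (C-mono c))

  R-cancel : ∀ {j k} → R j < R k → fun σ k F.< fun σ j
  R-cancel {j} {k} lt with FP.<-cmp (fun σ k) (fun σ j)
  ... | tri< a _ _ = a
  ... | tri≈ _ eq _ = contradiction lt (<-irrefl (cong R (sym (inj σ eq))))
  ... | tri> _ _ c = contradiction lt (ℕ.<-asym (R-anti c))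

  C-injective : Injective _≡_ _≡_ C
  C-injective {j} {k} eq with FP.<-cmp j k
  ... | tri< a _ _ = contradiction (C-mono a) (<-irrefl eq)
  ... | tri≈ _ j≡k _ = j≡k
  ... | tri> _ _ c = contradiction (C-mono c) (<-irrefl (sym eq))

  R-injective : Injective _≡_ _≡_ R
  R-injective {j} {k} eq with FP.<-cmp (fun σ k) (fun σ j)
  ... | tri< a _ _ = contradiction (R-anti a) (<-irrefl eq)
  ... | tri≈ _ σk≡σj _ = sym (inj σ σk≡σj)
  ... | tri> _ _ c = contradiction (R-anti c) (<-irrefl (sym eq))

  open Staircase R C T 2≤T R-injective C-injective 3+R≤C C<T public

  σ≼std : σ ≼ std
  σ≼std = ≼-std σ e (λ lt → inj₁ (C-mono lt)) (λ lt → inj₁ (R-anti lt))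

  e-≺⁻ : ∀ {j k} → e j ≺ e k → j F.< k
  e-≺⁻ lt = C-cancel (<ₗ⇒< ℕ.≤-refl lt)

  e-⋖⁻ : ∀ {j k} → e j ⋖ e k → fun σ j F.< fun σ k
  e-⋖⁻ lt = R-cancel (<ₗ⇒< ℕ.≤-refl lt)

  -- The common time separates them: `R k < t` and `t ≤ C j`.
  straddles⇒R<C : ∀ {t j k} → Straddles t (e j) → Straddles t (e k) → R k < C j
  straddles⇒R<C (t<j , _) (_ , k<t) = <-≤-trans (<ₗ⇒< (s≤s z≤n) k<t) (<ₗ⇒≤ t<j)

-- The extension avoids π.

module Avoidance {k} {f : Fin (5 + k) → Fin (5 + k)} (f-inj : Injective _≡_ _≡_ f)
                 (form : FormOneNTwo (perm (5 + k) f f-inj)) {σ : Perm} (s : Schedule σ) where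
  open OneNTwo f-inj form
  open Schedule s using (lower-left)
  open Extension s

  module _ (h : Fin (5 + k) → Pt) (h-≺ : ∀ i j → i F.< j → h i ≺ h j)
           (h-⋖ : ∀ i j → f i F.< f j → h i ⋖ h j) where

    t : ℕ
    t = guard (h zero)

    straddles : ∀ i → Straddles t (h (suc i))
    straddles i = above⇒straddles (h zero) (h (suc i)) (h-≺ zero (suc i) (s≤s z≤n))
      (h-⋖ zero (suc i) (subst (_< toℕ (f (suc i))) (sym f-first) (f-nonzero i)))

    inner : ∀ i → suc (suc i) ≢ last → Arc (h (suc (suc i)))
    inner i i≢last = inner-arc (h (suc zero)) (h (suc (suc i))) (h last)
      (straddles zero) (straddles (suc i)) (straddles (fromℕ (3 + k)))
      (h-≺ (suc zero) (suc (suc i)) (s≤s (s≤s z≤n))) (h-⋖ last (suc (suc i)) (last-< i≢last))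

    2F 3F : Fin (5 + k)
    2F = suc (suc zero)
    3F = suc (suc (suc zero))

    -- Length at least five puts positions 2 and 3 strictly between those of n and 2, which gives
    -- the two arcs that `first-arc` and `last-arc` require.
    arc₂ : Arc (h 2F)
    arc₂ = inner zero λ ()

    arc₃ : Arc (h 3F)
    arc₃ = inner (suc zero) λ ()

    distinct : proj₁ arc₂ ≢ proj₁ arc₃
    distinct eq = <ₗ-irrefl (subst (h 2F ≺_)
      (trans (proj₂ arc₃) (trans (cong e (sym eq)) (sym (proj₂ arc₂)))) (h-≺ 2F 3F (n<1+n 2)))

    first : Arc (h (suc zero))
    first = first-arc (h (suc zero)) (straddles zero)
      (subst (Straddles t) (proj₂ arc₂) (straddles (suc zero)))
      (subst (Straddles t) (proj₂ arc₃) (straddles (suc (suc zero)))) distinct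
      (subst (_⋖ h (suc zero)) (proj₂ arc₂) (h-⋖ 2F (suc zero) (<-second λ ())))
      (subst (_⋖ h (suc zero)) (proj₂ arc₃) (h-⋖ 3F (suc zero) (<-second λ ())))

    final : Arc (h last)
    final = last-arc (h last) (straddles (fromℕ (3 + k)))
      (subst (Straddles t) (proj₂ arc₂) (straddles (suc zero)))
      (subst (Straddles t) (proj₂ arc₃) (straddles (suc (suc zero)))) distinct
      (subst (_≺ h last) (proj₂ arc₂) (h-≺ 2F last (<-last λ ())))
      (subst (_≺ h last) (proj₂ arc₃) (h-≺ 3F last (<-last λ ())))

    arcs : ∀ i → Arc (h (suc i))
    arcs zero = first
    arcs (suc i) with suc (suc i) FP.≟ last
    ... | yes eq = subst (Arc ∘ h) (sym eq) final
    ... | no i≢last = inner i i≢last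

    entry : Fin (4 + k) → Fin (len σ)
    entry i = proj₁ (arcs i)

    entry-mono : ∀ i j → i F.< j → entry i F.< entry j
    entry-mono i j lt = e-≺⁻ (subst₂ _≺_ (proj₂ (arcs i)) (proj₂ (arcs j)) (h-≺ (suc i) (suc j) (s≤s lt)))

    entry-order : ∀ i j → f (suc i) F.< f (suc j) → fun σ (entry i) F.< fun σ (entry j)
    entry-order i j lt = e-⋖⁻ (subst₂ _⋖_ (proj₂ (arcs i)) (proj₂ (arcs j)) (h-⋖ (suc i) (suc j) lt))

    entry-straddles : ∀ i → Straddles t (e (entry i))
    entry-straddles i = subst (Straddles t) (proj₂ (arcs i)) (straddles i)

    π≼σ : π ≼ σ
    π≼σ = let z , z<first , σz<σlast = corner in
      ≼-from-corner σ entry entry-mono entry-order z z<first σz<σlast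
      where
      lastEntry : Fin (4 + k)
      lastEntry = fromℕ (3 + k)

      -- The images of n and 2 form a descent of σ and straddle the same time, so the row of the
      -- latter is crossed before the column of the former.
      corner : ∃ λ z → z F.< entry zero × fun σ z F.< fun σ (entry lastEntry)
      corner = lower-left {entry zero} {entry lastEntry} (entry-mono zero lastEntry (s≤s z≤n))
        (entry-order lastEntry zero (<-second λ ()))
        (straddles⇒R<C {t} {entry zero} {entry lastEntry} (entry-straddles zero) (entry-straddles lastEntry))

  avoids : Av π σ → Av π std
  avoids π⋠σ π≼std = let h , h-≺ , h-⋖ = ≼-std⁻ π π≼std in π⋠σ (π≼σ h h-≺ h-⋖)

  simple-extension : Av π σ → ∃ λ τ → σ ≼ τ × Simple τ × Av π τ
  simple-extension π⋠σ = std , σ≼std , std-simple , avoids π⋠σ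

-- Deflatability and the conclusion.

not-deflatable : ∀ {C : PermSet} →
                 (∀ σ → C σ → ∃ λ τ → σ ≼ τ × Simple τ × C τ) → ¬ Deflatable C
not-deflatable extend (D , D-class , _ , (σ , Cσ , ¬Dσ) , closure) =
  -- `E` and `D` have the same simple members, so `τ` lies in `D`, and downward closure brings `σ`
  -- into `D`.
  let τ , σ≼τ , simple , Cτ = extend σ Cσ
      E , _ , E⇔D , Eτ = closure τ Cτ
  in ¬Dσ (D-class σ τ σ≼τ (to (E⇔D τ simple) Eτ))

-- The only candidates of lengths 3 and 4 are 132 and 1432, whose second and third entries form a
-- decreasing bond.
length≥5 : (π : Perm) → 3 ≤ len π → FormOneNTwo π → ¬ HasDecreasingBond π → 5 ≤ len π
length≥5 (perm (suc zero) _ _) (s≤s ()) _ _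
length≥5 (perm (suc (suc zero)) _ _) (s≤s (s≤s ())) _ _
length≥5 (perm 3 f f-inj) _ (_ , second , final) no-bond = contradiction
  (suc zero , suc (suc zero) , refl ,
    trans (second (suc zero) refl) (cong suc (sym (final (suc (suc zero)) refl)))) no-bond
length≥5 (perm 4 f f-inj) _ (first , second , final) no-bond = contradiction
  (suc zero , suc (suc zero) , refl ,
    trans (second (suc zero) refl) (cong suc (sym (middle (f 2F) refl)))) no-bond
  where
  2F 3F : Fin 4
  2F = suc (suc zero)
  3F = suc (suc (suc zero))
  absent : ∀ {i} → i ≢ 2F → toℕ (f i) ≢ toℕ (f 2F)
  absent i≢2 eq = i≢2 (f-inj (toℕ-injective eq))
  middle : ∀ v → f 2F ≡ v → toℕ v ≡ 2
  middle zero eq = contradiction (trans (first zero refl) (cong toℕ (sym eq))) (absent λ ())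
  middle (suc zero) eq = contradiction (trans (final 3F refl) (cong toℕ (sym eq))) (absent λ ())
  middle (suc (suc zero)) _ = refl
  middle (suc (suc (suc zero))) eq =
    contradiction (trans (second (suc zero) refl) (cong toℕ (sym eq))) (absent λ ())
length≥5 (perm (suc (suc (suc (suc (suc _))))) _ _) _ _ _ = s≤s (s≤s (s≤s (s≤s (s≤s z≤n))))

theorem3p7 : (π : Perm) → 3 ≤ len π → FormOneNTwo π →
    ¬ HasDecreasingBond π → ¬ Deflatable (Av π)
theorem3p7 π@(perm _ f f-inj) 3≤n form no-bond with length≥5 π 3≤n form no-bond
-- Matching on the bound exposes the length as `5 + k`, the form in which `Avoidance` takes π.
... | s≤s (s≤s (s≤s (s≤s (s≤s z≤n)))) = not-deflatable λ σ → Avoidance.simple-extension f-inj form (Times.schedule σ)
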